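{- Let $\mathcal A$ be a finite alphabet and $\Psi: \mathcal A^*\to \mathcal A^*$. Then $\Psi$ is a symmetry if and only if $\Psi$ is a morphism or an antimorphism whose restriction to $\mathcal A$ is a permutation of the letters of $\mathcal A$.
   Context: A symmetry on $\mathcal A^*$ is a map $\Psi:\mathcal A^*\to\mathcal A^*$ such that (1) $\Psi$ is a bijection and (2) for all $w,v\in\mathcal A^*$, the number of occurrences of $w$ in $v$ equals the number of occurrences of $\Psi(w)$ in $\Psi(v)$ (an occurrence of $w$ in $v=v_1\cdots v_m$ is an index $i$ such that $w$ is a prefix of $v_iv_{i+1}\cdots v_m$). $\Psi$ is a morphism if $\Psi(vw)=\Psi(v)\Psi(w)$ and an antimorphism if $\Psi(vw)=\Psi(w)\Psi(v)$ for all $v,w\in\mathcal A^*$. -}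

module Defs where

open import Data.Fin.Base using (Fin; toℕ)
open import Data.Fin.Properties using (inj⇒≟)
open import Data.List.Base using (List; _++_; [_]; length; drop; filter; allFin)
open import Data.List.Relation.Binary.Prefix.Heterogeneous using (Prefix)
open import Data.List.Relation.Binary.Prefix.Heterogeneous.Properties using (prefix?)
open import Data.Nat.Base using (ℕ)
open import Data.Product.Base using (Σ-syntax)
open import Function.Bundles using (_↔_; _⤖_; module Bijection)
open import Function.Definitions using (Bijective)
open import Function.Properties.Inverse using (↔⇒↣)
open import Relation.Binary.Definitions using (DecidableEquality)
open import Relation.Binary.PropositionalEquality using (_≡_)

record Finite {a} (A : Set a) : Set a where
  field
    size  : ℕ
    enum  : A ↔ Fin size

  _≟_ : DecidableEquality A
  _≟_ = inj⇒≟ (↔⇒↣ enum)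

module _ {a} {A : Set a} where

  -- Positions are 0-based: i : Fin m stands for the index i + 1 of
  -- v = v₁⋯vₘ, and drop i v is the (nonempty) suffix vᵢ₊₁⋯vₘ.
  IsOccurrence : (w v : List A) → Fin (length v) → Set a
  IsOccurrence w v i = Prefix _≡_ w (drop (toℕ i) v)

  -- As indices range over 1, …, m only, the empty word has m occurrences
  -- in a word of length m.
  occurrences : DecidableEquality A → (w v : List A) → ℕ
  occurrences _≟_ w v =
    length (filter {P = IsOccurrence w v} (λ i → prefix? _≟_ w (drop (toℕ i) v)) (allFin (length v)))

  record IsSymmetry (finite : Finite A) (Ψ : List A → List A) : Set a where
    open Finite finite
    field
      bijective            : Bijective _≡_ _≡_ Ψ
      preservesOccurrences : ∀ w v → occurrences _≟_ w v ≡ occurrences _≟_ (Ψ w) (Ψ v)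

  IsMorphism : (List A → List A) → Set a
  IsMorphism Ψ = ∀ v w → Ψ (v ++ w) ≡ Ψ v ++ Ψ w

  IsAntimorphism : (List A → List A) → Set a
  IsAntimorphism Ψ = ∀ v w → Ψ (v ++ w) ≡ Ψ w ++ Ψ v

  RestrictsToPermutation : (List A → List A) → Set a
  RestrictsToPermutation Ψ = Σ[ π ∈ A ⤖ A ] (∀ x → Ψ [ x ] ≡ [ Bijection.to π x ])

{-# OPTIONS --safe #-}
module Submission where

-- Counting occurrences of the empty word shows that a symmetry preserves
-- length, so it permutes the letters; after composing with the inverse
-- permutation we may assume that it fixes them.
-- As soon as all words of length n ≥ 1 are fixed, a word of length n + 1 and
-- its image have the same multiset of factors of length n. For n = 1, each
-- two-letter word is fixed or reversed, and looking at three-letter words, one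
-- properly reversed pair forces all pairs to be reversed; composing with
-- reversal we may assume that all two-letter words are fixed. For n ≥ 2, if
-- the prefix and the suffix of length n were exchanged, then the word would be
-- x m and its image m z, and counting the first letter and the first
-- two-letter factor of x m forces the word to be a power of x.

open import Defs
open import Data.Bool.Base using (if_then_else_; true; false)
open import Data.Fin.Base using (Fin; zero; suc; toℕ)
open import Data.Fin.Properties using (∀-cons)
open import Data.List.Base using (List; []; _∷_; _++_; [_]; _∷ʳ_; map; reverse; length; drop; filter; tabulate; initLast; _∷ʳ′_)
open import Data.List.Properties using (≡-dec; ∷-injective; ∷-injectiveˡ; map-id; map-cong; map-∘; map-++; map-injective; reverse-++; reverse-injective; reverse-involutive; unfold-reverse; length-++; ++-identityʳ-unique)
open import Data.List.Relation.Binary.Prefix.Heterogeneous using (Prefix; []; _∷_)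
open import Data.List.Relation.Binary.Prefix.Heterogeneous.Properties using (prefix?; length-mono)
open import Data.Nat.Base using (ℕ; zero; suc; _+_; _<_; _≤_; s≤s; z≤n)
open import Data.Nat.Properties using (+-assoc; +-comm; +-cancelˡ-≡; +-identityʳ; suc-injective; ≤-reflexive; m≤n⇒m≤o+n; <⇒≱; n≮n; <⇒≤)
open import Data.Product.Base using (_×_; _,_; proj₁; proj₂; ∃; ∃₂)
open import Data.Sum.Base as Sum using (_⊎_; inj₁; inj₂; [_,_]′)
open import Function.Base using (_∘_; id)
open import Function.Bundles using (_⇔_; mk⇔; mk⤖; module Bijection; module Inverse)
open import Function.Consequences.Propositional using (strictlySurjective⇒surjective)
open import Function.Construct.Composition using () renaming (bijective to ∘-bijective)
open import Function.Definitions using (Injective; Bijective)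
open import Relation.Binary.Definitions using (DecidableEquality)
open import Relation.Binary.PropositionalEquality using (_≡_; _≢_; _≗_; refl; sym; trans; cong; cong₂; subst; module ≡-Reasoning)
open import Relation.Nullary.Decidable.Core using (Dec; yes; no; does)
open import Relation.Nullary.Negation.Core using (¬_; contradiction)
open import Relation.Unary using (Pred; Decidable)

open ≡-Reasoning

-- Iverson brackets

module _ {p} {P : Set p} where

  ⟦_⟧ : Dec P → ℕ
  ⟦ P? ⟧ = if does P? then 1 else 0

  ⟦⟧-yes : (P? : Dec P) → P → ⟦ P? ⟧ ≡ 1
  ⟦⟧-yes (yes _) _ = refl
  ⟦⟧-yes (no ¬p) p = contradiction p ¬p

  ⟦⟧-no : (P? : Dec P) → ¬ P → ⟦ P? ⟧ ≡ 0
  ⟦⟧-no (yes p) ¬p = contradiction p ¬p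
  ⟦⟧-no (no _)  _  = refl

  0<⟦⟧⇒ : (P? : Dec P) → 0 < ⟦ P? ⟧ → P
  0<⟦⟧⇒ (yes p) _ = p

  ⟦⟧≡1⇒ : (P? : Dec P) → ⟦ P? ⟧ ≡ 1 → P
  ⟦⟧≡1⇒ P? eq = 0<⟦⟧⇒ P? (≤-reflexive (sym eq))

⟦⟧-cong : ∀ {p q} {P : Set p} {Q : Set q} (P? : Dec P) (Q? : Dec Q) →
          (P → Q) → (Q → P) → ⟦ P? ⟧ ≡ ⟦ Q? ⟧
⟦⟧-cong (yes p) Q? f g = sym (⟦⟧-yes Q? (f p))
⟦⟧-cong (no ¬p) Q? f g = sym (⟦⟧-no Q? (¬p ∘ g))

-- The count at `p` is positive, so `p` is `p′` or `q′`; cancelling the matched terms from the count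
-- at `q` forces `q` to be the other one.
pair-multiset-≡ : ∀ {b} {B : Set b} (_≟_ : DecidableEquality B) {p q p′ q′ : B} →
  ⟦ p ≟ p ⟧ + ⟦ p ≟ q ⟧ ≡ ⟦ p ≟ p′ ⟧ + ⟦ p ≟ q′ ⟧ →
  ⟦ q ≟ p ⟧ + ⟦ q ≟ q ⟧ ≡ ⟦ q ≟ p′ ⟧ + ⟦ q ≟ q′ ⟧ →
  (p ≡ p′ × q ≡ q′) ⊎ (p ≡ q′ × q ≡ p′)
pair-multiset-≡ _≟_ {p} {q} {p′} {q′} at-p at-q with p ≟ p′ | p ≟ q′
... | yes refl | _ = inj₁ (refl , ⟦⟧≡1⇒ (q ≟ q′) (begin
  ⟦ q ≟ q′ ⟧ ≡⟨ +-cancelˡ-≡ ⟦ q ≟ p ⟧ _ _ at-q ⟨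
  ⟦ q ≟ q ⟧  ≡⟨ ⟦⟧-yes (q ≟ q) refl ⟩
  1          ∎))
... | no _ | yes refl = inj₂ (refl , ⟦⟧≡1⇒ (q ≟ p′) (begin
  ⟦ q ≟ p′ ⟧ ≡⟨ +-cancelˡ-≡ ⟦ q ≟ p ⟧ _ _ (trans at-q (+-comm ⟦ q ≟ p′ ⟧ _)) ⟨
  ⟦ q ≟ q ⟧  ≡⟨ ⟦⟧-yes (q ≟ q) refl ⟩
  1          ∎))
-- Once `p ≟ p` evaluates to `yes`, `at-p` equates a successor with 0.
... | no _ | no _ with p ≟ p
...   | no p≢p = contradiction refl p≢p
pair-multiset-≡ _ () _ | no _ | no _ | yes _

-- Finite sets and lists

Fin-∀-⊎ : ∀ {p q} n {P : Fin n → Set p} {Q : Set q} →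
          (∀ i → P i ⊎ Q) → (∀ i → P i) ⊎ Q
Fin-∀-⊎ zero    f = inj₁ λ ()
Fin-∀-⊎ (suc n) f with f zero | Fin-∀-⊎ n (f ∘ suc)
... | inj₂ q | _       = inj₂ q
... | inj₁ _ | inj₂ q  = inj₂ q
... | inj₁ p | inj₁ ps = inj₁ (∀-cons p ps)

-- Constructively this takes a search through the finitely many elements. It serves to choose
-- between fixing and reversing once for all pairs of letters.
Finite-∀-⊎ : ∀ {a p q} {A : Set a} → Finite A → {P : A → Set p} {Q : Set q} →
             (∀ x → P x ⊎ Q) → (∀ x → P x) ⊎ Q
Finite-∀-⊎ finite {P} f =
  [ (λ ps → inj₁ λ x → subst P (strictlyInverseʳ x) (ps (to x))) , inj₂ ]′
    (Fin-∀-⊎ size (f ∘ from))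
  where
  open Finite finite
  open Inverse enum

-- With `suc` for `g`, this identifies the later positions of `x ∷ v` with the positions of `v`.
length-filter-tabulate-∘ : ∀ {b c p} {B : Set b} {C : Set c} {P : Pred C p} (P? : Decidable P)
  (g : B → C) {n} (f : Fin n → B) →
  length (filter P? (tabulate (g ∘ f))) ≡ length (filter (P? ∘ g) (tabulate f))
length-filter-tabulate-∘ P? g {zero}  f = refl
length-filter-tabulate-∘ P? g {suc n} f with does (P? (g (f zero)))
... | true  = cong suc (length-filter-tabulate-∘ P? g (f ∘ suc))
... | false = length-filter-tabulate-∘ P? g (f ∘ suc)

module _ {a} {A : Set a} where

  length-∷ʳ : ∀ (v : List A) x → length (v ∷ʳ x) ≡ suc (length v)
  length-∷ʳ v x = trans (length-++ v) (+-comm (length v) 1)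

  length≡1⇒ : ∀ (v : List A) → length v ≡ 1 → ∃ λ x → v ≡ [ x ]
  length≡1⇒ (x ∷ []) _ = x , refl

  -- A view through both end letters, which makes the factors `x ∷ u` and `u ∷ʳ y` accessible.
  data Bordered : List A → Set a where
    bordered : ∀ x u y → Bordered (x ∷ u ∷ʳ y)

  length≥2⇒Bordered : ∀ {n} (v : List A) → length v ≡ suc (suc n) → Bordered v
  length≥2⇒Bordered (x ∷ v) _ with initLast v
  length≥2⇒Bordered (x ∷ .[]) () | []
  ... | u ∷ʳ′ y = bordered x u y

  length-bordered : ∀ (x : A) u y → length (x ∷ u ∷ʳ y) ≡ suc (suc (length u))
  length-bordered x u y = cong suc (length-∷ʳ u y)

  reverse-∷ʳ : ∀ (v : List A) x → reverse (v ∷ʳ x) ≡ x ∷ reverse v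
  reverse-∷ʳ v x = reverse-++ v [ x ]

  -- A nonempty `t` begins with `x`, and removing that letter leaves an equation of the same form.
  ∷ʳ-comm-∷ : ∀ (x : A) t → x ∷ x ∷ t ≡ t ∷ʳ x ∷ʳ x → t ∷ʳ x ≡ x ∷ t
  ∷ʳ-comm-∷ x []      _  = refl
  ∷ʳ-comm-∷ x (b ∷ t) eq with refl , eq′ ← ∷-injective eq = cong (x ∷_) (∷ʳ-comm-∷ x t eq′)

  map-bijective : ∀ {π : A → A} → Bijective _≡_ _≡_ π → Bijective _≡_ _≡_ (map π)
  map-bijective {π} (inj , surj) = map-injective inj , strictlySurjective⇒surjective
    (λ v → map (proj₁ ∘ surj) v , (begin
      map π (map (proj₁ ∘ surj) v) ≡⟨ map-∘ v ⟨
      map (π ∘ proj₁ ∘ surj) v     ≡⟨ map-cong (λ y → proj₂ (surj y) refl) v ⟩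
      map id v                     ≡⟨ map-id v ⟩
      v                            ∎))

  reverse-bijective : Bijective _≡_ _≡_ (reverse {A = A})
  reverse-bijective = reverse-injective , strictlySurjective⇒surjective
    (λ v → reverse v , reverse-involutive v)

  bijective-≗ : ∀ {f g : List A → List A} → f ≗ g → Bijective _≡_ _≡_ g → Bijective _≡_ _≡_ f
  bijective-≗ f≗g (inj , surj) =
    (λ {v} {w} eq → inj (trans (sym (f≗g v)) (trans eq (f≗g w)))) ,
    strictlySurjective⇒surjective (λ y → proj₁ (surj y) , trans (f≗g _) (proj₂ (surj y) refl))

  -- Morphisms and antimorphisms are determined by their values on letters

  module _ {Ψ : List A → List A} {π : A → A} (Ψ-letter : ∀ x → Ψ [ x ] ≡ [ π x ]) where

    morphism≗map : IsMorphism Ψ → Ψ ≗ map π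
    -- `Ψ []` equals its own square, so it is empty.
    morphism≗map hom []      = ++-identityʳ-unique (Ψ []) (hom [] [])
    morphism≗map hom (x ∷ v) = trans (hom [ x ] v) (cong₂ _++_ (Ψ-letter x) (morphism≗map hom v))

    antimorphism≗reverse∘map : IsAntimorphism Ψ → Ψ ≗ reverse ∘ map π
    antimorphism≗reverse∘map anti []      = ++-identityʳ-unique (Ψ []) (anti [] [])
    antimorphism≗reverse∘map anti (x ∷ v) = begin
      Ψ (x ∷ v)                 ≡⟨ anti [ x ] v ⟩
      Ψ v ++ Ψ [ x ]            ≡⟨ cong₂ _++_ (antimorphism≗reverse∘map anti v) (Ψ-letter x) ⟩
      reverse (map π v) ∷ʳ π x  ≡⟨ unfold-reverse (π x) (map π v) ⟨
      reverse (π x ∷ map π v)   ∎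

  module _ {Ψ : List A → List A} {π : A → A} where

    ≗map⇒morphism : Ψ ≗ map π → IsMorphism Ψ
    ≗map⇒morphism eq v w = begin
      Ψ (v ++ w)         ≡⟨ eq (v ++ w) ⟩
      map π (v ++ w)     ≡⟨ map-++ π v w ⟩
      map π v ++ map π w ≡⟨ cong₂ _++_ (eq v) (eq w) ⟨
      Ψ v ++ Ψ w         ∎

    ≗map∘reverse⇒antimorphism : Ψ ≗ map π ∘ reverse → IsAntimorphism Ψ
    ≗map∘reverse⇒antimorphism eq v w = begin
      Ψ (v ++ w)                              ≡⟨ eq (v ++ w) ⟩
      map π (reverse (v ++ w))                ≡⟨ cong (map π) (reverse-++ v w) ⟩
      map π (reverse w ++ reverse v)          ≡⟨ map-++ π (reverse w) (reverse v) ⟩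
      map π (reverse w) ++ map π (reverse v)  ≡⟨ cong₂ _++_ (eq w) (eq v) ⟨
      Ψ w ++ Ψ v                              ∎

-- Counting occurrences by recursion on the word

module Occurrences {a} {A : Set a} (_≟_ : DecidableEquality A) where

  occ : List A → List A → ℕ
  occ = occurrences _≟_

  pre : List A → List A → ℕ
  pre w v = ⟦ prefix? _≟_ w v ⟧

  eq : List A → List A → ℕ
  eq w v = ⟦ ≡-dec _≟_ w v ⟧

  -- Position zero contributes the `pre` term; the others are the positions of `v` shifted by one.
  occ-∷ : ∀ w x v → occ w (x ∷ v) ≡ pre w (x ∷ v) + occ w v
  occ-∷ w x v with does (prefix? _≟_ w (x ∷ v))
  ... | true  = cong suc (length-filter-tabulate-∘ P? suc {length v} id)
    where P? = λ (i : Fin (suc (length v))) → prefix? _≟_ w (drop (toℕ i) (x ∷ v))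
  ... | false = length-filter-tabulate-∘ P? suc {length v} id
    where P? = λ (i : Fin (suc (length v))) → prefix? _≟_ w (drop (toℕ i) (x ∷ v))

  occ-[] : ∀ v → occ [] v ≡ length v
  occ-[] []      = refl
  occ-[] (x ∷ v) = trans (occ-∷ [] x v) (cong suc (occ-[] v))

  Prefix-refl : ∀ (w : List A) → Prefix _≡_ w w
  Prefix-refl []      = []
  Prefix-refl (x ∷ w) = refl ∷ Prefix-refl w

  0<occ-here : ∀ w x v → Prefix _≡_ w (x ∷ v) → 0 < occ w (x ∷ v)
  0<occ-here w x v w⊑ rewrite occ-∷ w x v | ⟦⟧-yes (prefix? _≟_ w (x ∷ v)) w⊑ = s≤s z≤n

  0<occ-there : ∀ w x v → 0 < occ w v → 0 < occ w (x ∷ v)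
  0<occ-there w x v 0< rewrite occ-∷ w x v = m≤n⇒m≤o+n (pre w (x ∷ v)) 0<

  0<occ-∷⁻ : ∀ w x v → 0 < occ w (x ∷ v) → Prefix _≡_ w (x ∷ v) ⊎ 0 < occ w v
  0<occ-∷⁻ w x v 0< rewrite occ-∷ w x v with prefix? _≟_ w (x ∷ v)
  ... | yes w⊑ = inj₁ w⊑
  ... | no _   = inj₂ 0<

  -- Invariance of occurrences under reversal

  -- A prefix of `v ∷ʳ x` is a prefix of `v` or the whole word, and never both since the lengths
  -- differ.
  pre-∷ʳ : ∀ w v x → pre w (v ∷ʳ x) ≡ pre w v + eq w (v ∷ʳ x)
  pre-∷ʳ []      []      x = refl
  pre-∷ʳ []      (b ∷ v) x = refl
  pre-∷ʳ (y ∷ w) [] x with y ≟ x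
  ... | no _  = refl
  pre-∷ʳ (y ∷ [])    [] x | yes _ = refl
  pre-∷ʳ (y ∷ _ ∷ _) [] x | yes _ = refl
  pre-∷ʳ (y ∷ w) (b ∷ v) x with y ≟ b
  ... | yes _ = pre-∷ʳ w v x
  ... | no _  = refl

  eq-reverse : ∀ w v → eq (reverse w) (reverse v) ≡ eq w v
  eq-reverse w v = ⟦⟧-cong (≡-dec _≟_ _ _) (≡-dec _≟_ w v) reverse-injective (cong reverse)

  -- The suffix indicator, encoded through reversal so that `pre-∷ʳ` yields its recursion.
  suf : List A → List A → ℕ
  suf w v = pre (reverse w) (reverse v)

  suf-∷ : ∀ w b v → suf w (b ∷ v) ≡ suf w v + eq w (b ∷ v)
  suf-∷ w b v = begin
    pre (reverse w) (reverse (b ∷ v))               ≡⟨ cong (pre (reverse w)) (unfold-reverse b v) ⟩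
    pre (reverse w) (reverse v ∷ʳ b)                ≡⟨ pre-∷ʳ (reverse w) (reverse v) b ⟩
    suf w v + eq (reverse w) (reverse v ∷ʳ b)       ≡⟨ cong (λ z → suf w v + eq (reverse w) z) (unfold-reverse b v) ⟨
    suf w v + eq (reverse w) (reverse (b ∷ v))      ≡⟨ cong (suf w v +_) (eq-reverse w (b ∷ v)) ⟩
    suf w v + eq w (b ∷ v)                          ∎

  pre-[]≡eq : ∀ w → pre w [] ≡ eq w []
  pre-[]≡eq []      = refl
  pre-[]≡eq (_ ∷ _) = refl

  pre-[]≡suf : ∀ w → pre w [] ≡ suf w []
  pre-[]≡suf w = begin
    pre w []            ≡⟨ pre-[]≡eq w ⟩
    eq w []             ≡⟨ eq-reverse w [] ⟨
    eq (reverse w) []   ≡⟨ pre-[]≡eq (reverse w) ⟨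
    pre (reverse w) []  ∎

  -- Both sides split off the same term eq w (b ∷ v ∷ʳ x).
  pre+suf : ∀ w b v x → pre w (b ∷ v ∷ʳ x) + suf w (v ∷ʳ x) ≡ pre w (b ∷ v) + suf w (b ∷ v ∷ʳ x)
  pre+suf w b v x = begin
    pre w (b ∷ v ∷ʳ x) + s    ≡⟨ cong (_+ s) (pre-∷ʳ w (b ∷ v) x) ⟩
    (pre w (b ∷ v) + e) + s   ≡⟨ +-assoc (pre w (b ∷ v)) e s ⟩
    pre w (b ∷ v) + (e + s)   ≡⟨ cong (pre w (b ∷ v) +_) (+-comm e s) ⟩
    pre w (b ∷ v) + (s + e)   ≡⟨ cong (pre w (b ∷ v) +_) (suf-∷ w b (v ∷ʳ x)) ⟨
    pre w (b ∷ v) + suf w (b ∷ v ∷ʳ x) ∎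
    where
    e = eq w (b ∷ v ∷ʳ x)
    s = suf w (v ∷ʳ x)

  -- The last term accounts for an occurrence that ends at `x`. The induction peels letters from the
  -- left, and `pre+suf` trades the boundary terms.
  occ-∷ʳ : ∀ w v x → occ w (v ∷ʳ x) ≡ occ w v + suf w (v ∷ʳ x)
  occ-∷ʳ w [] x = begin
    occ w [ x ]              ≡⟨ occ-∷ w x [] ⟩
    pre w [ x ] + 0          ≡⟨ +-identityʳ _ ⟩
    pre w [ x ]              ≡⟨ pre-∷ʳ w [] x ⟩
    pre w [] + eq w [ x ]    ≡⟨ cong (_+ eq w [ x ]) (pre-[]≡suf w) ⟩
    suf w [] + eq w [ x ]    ≡⟨ suf-∷ w x [] ⟨
    suf w [ x ]              ∎
  occ-∷ʳ w (b ∷ v) x = begin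
    occ w (b ∷ v ∷ʳ x)                                    ≡⟨ occ-∷ w b (v ∷ʳ x) ⟩
    pre w (b ∷ v ∷ʳ x) + occ w (v ∷ʳ x)                   ≡⟨ cong (pre w (b ∷ v ∷ʳ x) +_) (trans (occ-∷ʳ w v x) (+-comm (occ w v) _)) ⟩
    pre w (b ∷ v ∷ʳ x) + (suf w (v ∷ʳ x) + occ w v)       ≡⟨ +-assoc (pre w (b ∷ v ∷ʳ x)) _ _ ⟨
    (pre w (b ∷ v ∷ʳ x) + suf w (v ∷ʳ x)) + occ w v       ≡⟨ cong (_+ occ w v) (pre+suf w b v x) ⟩
    (pre w (b ∷ v) + suf w (b ∷ v ∷ʳ x)) + occ w v        ≡⟨ +-assoc (pre w (b ∷ v)) _ _ ⟩
    pre w (b ∷ v) + (suf w (b ∷ v ∷ʳ x) + occ w v)        ≡⟨ cong (pre w (b ∷ v) +_) (+-comm _ (occ w v)) ⟩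
    pre w (b ∷ v) + (occ w v + suf w (b ∷ v ∷ʳ x))        ≡⟨ +-assoc (pre w (b ∷ v)) _ _ ⟨
    (pre w (b ∷ v) + occ w v) + suf w (b ∷ v ∷ʳ x)        ≡⟨ cong (_+ suf w (b ∷ v ∷ʳ x)) (occ-∷ w b v) ⟨
    occ w (b ∷ v) + suf w (b ∷ v ∷ʳ x)                    ∎

  -- Maps that preserve occurrences

  PreservesOccurrences : (List A → List A) → Set a
  PreservesOccurrences φ = ∀ w v → occ w v ≡ occ (φ w) (φ v)

  ∘-preservesOccurrences : ∀ φ ψ → PreservesOccurrences φ → PreservesOccurrences ψ →
                           PreservesOccurrences (ψ ∘ φ)
  ∘-preservesOccurrences φ ψ pφ pψ w v = trans (pφ w v) (pψ (φ w) (φ v))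

  ≗-preservesOccurrences : ∀ φ ψ → φ ≗ ψ → PreservesOccurrences ψ → PreservesOccurrences φ
  ≗-preservesOccurrences φ ψ φ≗ψ pψ w v = trans (pψ w v) (sym (cong₂ occ (φ≗ψ w) (φ≗ψ v)))

  -- Removing the first letter of a word removes the last letter of its reversal, and reversal
  -- exchanges the boundary terms `pre` and `suf`.
  reverse-preservesOccurrences : PreservesOccurrences reverse
  reverse-preservesOccurrences w []      = refl
  reverse-preservesOccurrences w (b ∷ v) = begin
    occ w (b ∷ v)                                          ≡⟨ occ-∷ w b v ⟩
    pre w (b ∷ v) + occ w v                                ≡⟨ +-comm (pre w (b ∷ v)) (occ w v) ⟩
    occ w v + pre w (b ∷ v)                                ≡⟨ cong₂ _+_ (reverse-preservesOccurrences w v) (cong₂ pre (sym (reverse-involutive w)) (sym (reverse-involutive (b ∷ v)))) ⟩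
    occ (reverse w) (reverse v) + suf (reverse w) (reverse (b ∷ v))  ≡⟨ cong (λ z → occ (reverse w) (reverse v) + suf (reverse w) z) (unfold-reverse b v) ⟩
    occ (reverse w) (reverse v) + suf (reverse w) (reverse v ∷ʳ b)   ≡⟨ occ-∷ʳ (reverse w) (reverse v) b ⟨
    occ (reverse w) (reverse v ∷ʳ b)                       ≡⟨ cong (occ (reverse w)) (unfold-reverse b v) ⟨
    occ (reverse w) (reverse (b ∷ v))                      ∎

  module _ {π : A → A} (π-inj : Injective _≡_ _≡_ π) where

    pre-map : ∀ w v → pre w v ≡ pre (map π w) (map π v)
    pre-map []      v       = refl
    pre-map (y ∷ w) []      = refl
    pre-map (y ∷ w) (b ∷ v) with y ≟ b | π y ≟ π b
    ... | yes _    | yes _     = pre-map w v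
    ... | no _     | no _      = refl
    ... | yes refl | no πy≢πy  = contradiction refl πy≢πy
    ... | no y≢b   | yes πy≡πb = contradiction (π-inj πy≡πb) y≢b

    map-preservesOccurrences : PreservesOccurrences (map π)
    map-preservesOccurrences w []      = refl
    map-preservesOccurrences w (b ∷ v) = begin
      occ w (b ∷ v)                                          ≡⟨ occ-∷ w b v ⟩
      pre w (b ∷ v) + occ w v                                ≡⟨ cong₂ _+_ (pre-map w (b ∷ v)) (map-preservesOccurrences w v) ⟩
      pre (map π w) (map π (b ∷ v)) + occ (map π w) (map π v) ≡⟨ occ-∷ (map π w) (π b) (map π v) ⟨
      occ (map π w) (map π (b ∷ v))                          ∎

  -- Words with the same factors

  Prefix-length-≡ : ∀ {w v : List A} → length w ≡ length v → Prefix _≡_ w v → w ≡ v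
  Prefix-length-≡ {v = []}    _  []          = refl
  Prefix-length-≡ {v = _ ∷ _} () []
  Prefix-length-≡             eq (refl ∷ w⊑) = cong (_ ∷_) (Prefix-length-≡ (suc-injective eq) w⊑)

  occ-long : ∀ w v → length v < length w → occ w v ≡ 0
  occ-long w []      _ = refl
  occ-long w (x ∷ v) l = begin
    occ w (x ∷ v)            ≡⟨ occ-∷ w x v ⟩
    pre w (x ∷ v) + occ w v  ≡⟨ cong₂ _+_ (⟦⟧-no (prefix? _≟_ w (x ∷ v)) (<⇒≱ l ∘ length-mono)) (occ-long w v (<⇒≤ l)) ⟩
    0                        ∎

  -- Only the first two positions leave room for two letters.
  pair-occ-triple : ∀ s t p q r → 0 < occ (s ∷ t ∷ []) (p ∷ q ∷ r ∷ []) →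
                    (s ≡ p × t ≡ q) ⊎ (s ≡ q × t ≡ r)
  pair-occ-triple s t p q r 0< with 0<occ-∷⁻ (s ∷ t ∷ []) p (q ∷ r ∷ []) 0<
  ... | inj₁ (s≡p ∷ t≡q ∷ []) = inj₁ (s≡p , t≡q)
  ... | inj₂ 0<′ with 0<occ-∷⁻ (s ∷ t ∷ []) q (r ∷ []) 0<′
  ...   | inj₁ (s≡q ∷ t≡r ∷ []) = inj₂ (s≡q , t≡r)
  ...   | inj₂ 0<″ = contradiction (subst (0 <_) (occ-long (s ∷ t ∷ []) (r ∷ []) (s≤s (s≤s z≤n))) 0<″) λ ()

  pre-same-length : ∀ w v → length w ≡ length v → pre w v ≡ eq w v
  pre-same-length w v l = ⟦⟧-cong (prefix? _≟_ w v) (≡-dec _≟_ w v)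
    (Prefix-length-≡ l) (λ { refl → Prefix-refl w })

  occ-same-length : ∀ w x v → length w ≡ suc (length v) → occ w (x ∷ v) ≡ eq w (x ∷ v)
  occ-same-length w x v l = begin
    occ w (x ∷ v)            ≡⟨ occ-∷ w x v ⟩
    pre w (x ∷ v) + occ w v  ≡⟨ cong₂ _+_ (pre-same-length w (x ∷ v) l) (occ-long w v (≤-reflexive (sym l))) ⟩
    eq w (x ∷ v) + 0         ≡⟨ +-identityʳ _ ⟩
    eq w (x ∷ v)             ∎

  eq-different-length : ∀ w v → length w ≢ length v → eq w v ≡ 0
  eq-different-length w v l = ⟦⟧-no (≡-dec _≟_ w v) (l ∘ cong length)

  -- Only the first two positions leave room for `w`, and at the second one it has to fill the rest
  -- of the word.
  occ-bordered : ∀ w x u y → length w ≡ suc (length u) →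
                 occ w (x ∷ u ∷ʳ y) ≡ eq w (x ∷ u) + eq w (u ∷ʳ y)
  occ-bordered w x u y l = trans (occ-∷ w x (u ∷ʳ y)) (cong₂ _+_ left (right u l))
    where
    left : pre w (x ∷ u ∷ʳ y) ≡ eq w (x ∷ u)
    left = begin
      pre w (x ∷ u ∷ʳ y)                    ≡⟨ pre-∷ʳ w (x ∷ u) y ⟩
      pre w (x ∷ u) + eq w (x ∷ u ∷ʳ y)     ≡⟨ cong₂ _+_ (pre-same-length w (x ∷ u) l)
                                                 (eq-different-length w (x ∷ u ∷ʳ y) λ l′ →
                                                   n≮n _ (≤-reflexive (sym (trans (sym l) (trans l′ (length-bordered x u y)))))) ⟩
      eq w (x ∷ u) + 0                      ≡⟨ +-identityʳ _ ⟩
      eq w (x ∷ u)                          ∎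

    -- Splitting `u` exposes the first letter of `u ∷ʳ y`, which `occ-same-length` asks for.
    right : ∀ u → length w ≡ suc (length u) → occ w (u ∷ʳ y) ≡ eq w (u ∷ʳ y)
    right []      l = occ-same-length w y [] l
    right (b ∷ u) l = occ-same-length w b (u ∷ʳ y) (trans l (cong suc (sym (length-∷ʳ u y))))

  same-border-factors : ∀ x u y x′ u′ y′ → length u ≡ length u′ →
    (∀ w → length w ≡ suc (length u) → occ w (x ∷ u ∷ʳ y) ≡ occ w (x′ ∷ u′ ∷ʳ y′)) →
    (x ∷ u ≡ x′ ∷ u′ × u ∷ʳ y ≡ u′ ∷ʳ y′) ⊎ (x ∷ u ≡ u′ ∷ʳ y′ × u ∷ʳ y ≡ x′ ∷ u′)
  same-border-factors x u y x′ u′ y′ |u|≡|u′| same =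
    pair-multiset-≡ (≡-dec _≟_) (counts (x ∷ u) refl) (counts (u ∷ʳ y) (length-∷ʳ u y))
    where
    counts : ∀ w → length w ≡ suc (length u) →
             eq w (x ∷ u) + eq w (u ∷ʳ y) ≡ eq w (x′ ∷ u′) + eq w (u′ ∷ʳ y′)
    counts w l = begin
      eq w (x ∷ u) + eq w (u ∷ʳ y)      ≡⟨ occ-bordered w x u y l ⟨
      occ w (x ∷ u ∷ʳ y)                ≡⟨ same w l ⟩
      occ w (x′ ∷ u′ ∷ʳ y′)             ≡⟨ occ-bordered w x′ u′ y′ (trans l (cong suc |u|≡|u′|)) ⟩
      eq w (x′ ∷ u′) + eq w (u′ ∷ʳ y′)  ∎

  -- The words share the factor `m`. Cancelling `occ w m` turns a prefix of one into a suffix of the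
  -- other, which is stated as a prefix of the reversal.
  rotate-prefix : ∀ w x m z → occ w (x ∷ m) ≡ occ w (m ∷ʳ z) → Prefix _≡_ w (x ∷ m) →
                  Prefix _≡_ (reverse w) (z ∷ reverse m)
  rotate-prefix w x m z same w⊑ = subst (Prefix _≡_ (reverse w)) (reverse-∷ʳ m z)
    (⟦⟧≡1⇒ (prefix? _≟_ _ _) (begin
      suf w (m ∷ʳ z)  ≡⟨ +-cancelˡ-≡ (occ w m) _ _ (begin
        occ w m + suf w (m ∷ʳ z)  ≡⟨ occ-∷ʳ w m z ⟨
        occ w (m ∷ʳ z)            ≡⟨ same ⟨
        occ w (x ∷ m)             ≡⟨ occ-∷ w x m ⟩
        pre w (x ∷ m) + occ w m   ≡⟨ +-comm (pre w (x ∷ m)) _ ⟩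
        occ w m + pre w (x ∷ m)   ∎) ⟩
      pre w (x ∷ m)   ≡⟨ ⟦⟧-yes (prefix? _≟_ w (x ∷ m)) w⊑ ⟩
      1               ∎))

  -- Occurrence-preserving maps that fix shorter words

  module _ (φ : List A → List A) (pres : PreservesOccurrences φ) where

    -- The empty word has no occurrence in itself, while every nonempty word has one.
    preserves-[] : φ [] ≡ []
    preserves-[] with φ [] | pres [] []
    ... | []    | _  = refl
    ... | x ∷ v | eq = contradiction (subst (0 <_) (sym eq) (0<occ-here (x ∷ v) x v (Prefix-refl (x ∷ v)))) λ ()

    preserves-length : ∀ v → length (φ v) ≡ length v
    preserves-length v = begin
      length (φ v)      ≡⟨ occ-[] (φ v) ⟨
      occ [] (φ v)      ≡⟨ cong (λ z → occ z (φ v)) preserves-[] ⟨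
      occ (φ []) (φ v)  ≡⟨ pres [] v ⟨
      occ [] v          ≡⟨ occ-[] v ⟩
      length v          ∎

    preserves-0<occ : ∀ w v → 0 < occ w v → 0 < occ (φ w) (φ v)
    preserves-0<occ w v = subst (0 <_) (pres w v)

    FixesLength : ℕ → Set a
    FixesLength n = ∀ v → length v ≡ n → φ v ≡ v

    -- The image is a separate variable `v′` so that it can be given in decomposed form.
    fixed-occ : ∀ {w} → φ w ≡ w → ∀ {v v′} → φ v ≡ v′ → occ w v ≡ occ w v′
    fixed-occ {w} φw≡w {v} refl = trans (pres w v) (cong (λ z → occ z (φ v)) φw≡w)

    -- The factors one letter shorter are fixed, so the word and its image contain them equally
    -- often and `same-border-factors` applies.
    fixed-or-swapped : ∀ n → FixesLength (suc n) → ∀ x u y → length u ≡ n →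
      φ (x ∷ u ∷ʳ y) ≡ x ∷ u ∷ʳ y ⊎
      (∃₂ λ x′ u′ → ∃ λ y′ → φ (x ∷ u ∷ʳ y) ≡ x′ ∷ u′ ∷ʳ y′ × x ∷ u ≡ u′ ∷ʳ y′ × u ∷ʳ y ≡ x′ ∷ u′)
    fixed-or-swapped n fix x u y refl
      with v′ ← φ (x ∷ u ∷ʳ y) in φv≡v′
      with bordered x′ u′ y′ ← length≥2⇒Bordered v′ (trans (cong length (sym φv≡v′)) (trans (preserves-length (x ∷ u ∷ʳ y)) (length-bordered x u y)))
      with same-border-factors x u y x′ u′ y′
             (suc-injective (suc-injective (begin
               suc (suc (length u))    ≡⟨ length-bordered x u y ⟨
               length (x ∷ u ∷ʳ y)     ≡⟨ preserves-length (x ∷ u ∷ʳ y) ⟨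
               length (φ (x ∷ u ∷ʳ y)) ≡⟨ cong length φv≡v′ ⟩
               length (x′ ∷ u′ ∷ʳ y′)  ≡⟨ length-bordered x′ u′ y′ ⟩
               suc (suc (length u′))   ∎)))
             (λ w l → fixed-occ (fix w l) φv≡v′)
    ... | inj₁ (xu≡ , uy≡) = inj₁ (sym (cong₂ _∷_ (∷-injectiveˡ xu≡) uy≡))
    ... | inj₂ (xu≡ , uy≡) = inj₂ (x′ , u′ , y′ , refl , xu≡ , uy≡)

    -- From letters to pairs and to longer words

    module _ (fix₁ : FixesLength 1) where

      pair-fixed-or-reversed : ∀ x y → φ (x ∷ y ∷ []) ≡ x ∷ y ∷ [] ⊎ φ (x ∷ y ∷ []) ≡ y ∷ x ∷ []
      pair-fixed-or-reversed x y with fixed-or-swapped 0 fix₁ x [] y refl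
      ... | inj₁ fixed = inj₁ fixed
      ... | inj₂ (_ , [] , _ , φxy≡ , refl , refl) = inj₂ φxy≡
      ... | inj₂ (_ , _ ∷ _ , _ , _ , _ , ())

      -- From length three on the middle part is nonempty, and its first letter `a` gives the
      -- two-letter prefix `x a` to be counted.
      fixes-length-suc : FixesLength 2 → ∀ n → FixesLength (2 + n) → FixesLength (3 + n)
      fixes-length-suc fix₂ n fix v l
        with length≥2⇒Bordered v l
      fixes-length-suc _ _ _ _ () | bordered x [] y
      ... | bordered x (a ∷ t) y
        with fixed-or-swapped (suc n) fix x (a ∷ t) y
               (suc-injective (suc-injective (trans (sym (length-bordered x (a ∷ t) y)) l)))
      ... | inj₁ fixed = fixed
      -- Swapped factors: with `m` for `a ∷ t ∷ʳ y`, the word is `x ∷ m` and its image `m ∷ʳ z`.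
      -- Counting `x` gives `z ≡ x`.
      ... | inj₂ (_ , _ , z , φv≡ , xu≡ , refl)
        with refl ∷ [] ← rotate-prefix [ x ] x (a ∷ t ∷ʳ y) z
                           (fixed-occ (fix₁ _ refl) φv≡) (refl ∷ [])
        -- Counting `x a` shows that the image ends in `x a`; its last letters are `y x`, so `a` and
        -- `y` equal `x`.
        with ax⊑ ← rotate-prefix (x ∷ a ∷ []) x (a ∷ t ∷ʳ y) x
                           (fixed-occ (fix₂ _ refl) φv≡) (refl ∷ refl ∷ [])
        with refl ∷ refl ∷ [] ← subst (λ r → Prefix _≡_ (a ∷ x ∷ []) (x ∷ r)) (reverse-∷ʳ (a ∷ t) y) ax⊑
        -- Now `xu≡` says that `x x t` equals `t x x`, so `x` commutes with `t`.
        = trans φv≡ (cong (λ s → x ∷ s ∷ʳ x) (∷ʳ-comm-∷ x t xu≡))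

      fixes-length : FixesLength 2 → ∀ n → FixesLength n
      fixes-length fix₂ 0 [] _ = preserves-[]
      fixes-length fix₂ 1 = fix₁
      fixes-length fix₂ 2 = fix₂
      fixes-length fix₂ (suc (suc (suc n))) = fixes-length-suc fix₂ n (fixes-length fix₂ (suc (suc n)))

      fixes-pairs⇒≗id : (∀ x y → φ (x ∷ y ∷ []) ≡ x ∷ y ∷ []) → φ ≗ id
      fixes-pairs⇒≗id fixed v = fixes-length (λ { (x ∷ y ∷ []) _ → fixed x y }) (length v) v refl

      -- If `y z` were fixed, the image of `x y z` would contain both `y x` and `y z`. Starting at
      -- the same position they force `z ≡ x`; overlapping in the middle letter they force `x ≡ y`
      -- or `z ≡ y`.
      reversed-pair-next : ∀ {x y} → x ≢ y → φ (x ∷ y ∷ []) ≡ y ∷ x ∷ [] →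
                           ∀ z → φ (y ∷ z ∷ []) ≡ z ∷ y ∷ []
      reversed-pair-next {x} {y} x≢y φxy≡yx z with pair-fixed-or-reversed y z
      ... | inj₂ reversed = reversed
      ... | inj₁ φyz≡yz with z ≟ y | z ≟ x
      ...   | yes refl | _ = φyz≡yz
      -- Here `x y` and `y x` would share the image `y x`, which occurs in itself although `x y`
      -- does not occur in `y x`.
      ...   | no _ | yes refl = contradiction
        (subst (0 <_) (begin
          occ (y ∷ x ∷ []) (y ∷ x ∷ [])             ≡⟨ cong₂ occ φxy≡yx φyz≡yz ⟨
          occ (φ (x ∷ y ∷ [])) (φ (y ∷ x ∷ []))     ≡⟨ pres (x ∷ y ∷ []) (y ∷ x ∷ []) ⟨
          occ (x ∷ y ∷ []) (y ∷ x ∷ [])             ≡⟨ occ-same-length (x ∷ y ∷ []) y (x ∷ []) refl ⟩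
          eq (x ∷ y ∷ []) (y ∷ x ∷ [])              ≡⟨ ⟦⟧-no (≡-dec _≟_ (x ∷ y ∷ []) (y ∷ x ∷ [])) (x≢y ∘ ∷-injectiveˡ) ⟩
          0                                         ∎)
          (0<occ-here (y ∷ x ∷ []) y (x ∷ []) (Prefix-refl (y ∷ x ∷ []))))
        λ ()
      ...   | no z≢y | no z≢x
        with φ (x ∷ y ∷ z ∷ []) | preserves-length (x ∷ y ∷ z ∷ [])
           | preserves-0<occ (x ∷ y ∷ []) (x ∷ y ∷ z ∷ []) (0<occ-here (x ∷ y ∷ []) x (y ∷ z ∷ []) (refl ∷ refl ∷ []))
           | preserves-0<occ (y ∷ z ∷ []) (x ∷ y ∷ z ∷ []) (0<occ-there (y ∷ z ∷ []) x (y ∷ z ∷ []) (0<occ-here (y ∷ z ∷ []) y (z ∷ []) (refl ∷ refl ∷ [])))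
      ...     | p ∷ q ∷ r ∷ [] | _ | yx-occurs | yz-occurs
        rewrite φxy≡yx | φyz≡yz
        with pair-occ-triple y x p q r yx-occurs | pair-occ-triple y z p q r yz-occurs
      ... | inj₁ (refl , refl) | inj₁ (refl , refl) = contradiction refl z≢x
      ... | inj₁ (refl , refl) | inj₂ (refl , refl) = contradiction refl x≢y
      ... | inj₂ (refl , refl) | inj₁ (refl , refl) = contradiction refl z≢y
      ... | inj₂ (refl , refl) | inj₂ (refl , refl) = contradiction refl z≢x

      -- Reversal passes from `x y` to `y c` and on to `c d`; when `y` is `c` one step suffices.
      reversed-pair⇒reverses-pairs : ∀ {x y} → x ≢ y → φ (x ∷ y ∷ []) ≡ y ∷ x ∷ [] →
                                     ∀ c d → φ (c ∷ d ∷ []) ≡ d ∷ c ∷ []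
      reversed-pair⇒reverses-pairs {x} {y} x≢y φxy≡yx c d with y ≟ c
      ... | yes refl = reversed-pair-next x≢y φxy≡yx d
      ... | no y≢c   = reversed-pair-next y≢c (reversed-pair-next x≢y φxy≡yx c) d

      fixes-or-reverses-pairs : Finite A →
        (∀ x y → φ (x ∷ y ∷ []) ≡ x ∷ y ∷ []) ⊎ (∀ x y → φ (x ∷ y ∷ []) ≡ y ∷ x ∷ [])
      fixes-or-reverses-pairs finite = Finite-∀-⊎ finite λ x → Finite-∀-⊎ finite (dichotomy x)
        where
        -- The right alternative is independent of `x` and `y`, as `Finite-∀-⊎` demands. A reversed
        -- pair of equal letters counts as fixed.
        dichotomy : ∀ x y → φ (x ∷ y ∷ []) ≡ x ∷ y ∷ [] ⊎ (∀ c d → φ (c ∷ d ∷ []) ≡ d ∷ c ∷ [])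
        dichotomy x y with pair-fixed-or-reversed x y | x ≟ y
        ... | inj₁ fixed    | _        = inj₁ fixed
        ... | inj₂ reversed | yes refl = inj₁ reversed
        ... | inj₂ reversed | no x≢y   = inj₂ (reversed-pair⇒reverses-pairs x≢y reversed)

  letter-fixing⇒≗id⊎≗reverse : Finite A → ∀ φ → PreservesOccurrences φ → (∀ x → φ [ x ] ≡ [ x ]) →
                               φ ≗ id ⊎ φ ≗ reverse
  letter-fixing⇒≗id⊎≗reverse finite φ pres letters
    with fixes-or-reverses-pairs φ pres (λ { (x ∷ []) _ → letters x }) finite
  ... | inj₁ fixed = inj₁ (fixes-pairs⇒≗id φ pres (λ { (x ∷ []) _ → letters x }) fixed)
  ... | inj₂ reversed = inj₂ λ v → trans (sym (reverse-involutive (φ v)))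
    (cong reverse (fixes-pairs⇒≗id (reverse ∘ φ)
      (∘-preservesOccurrences φ reverse pres reverse-preservesOccurrences)
      (λ { (x ∷ []) _ → cong reverse (letters x) })
      (λ x y → cong reverse (reversed x y)) v))

-- Symmetries and permutations of the letters

module _ {a} {A : Set a} (finite : Finite A) {Ψ : List A → List A} where

  open Finite finite
  open Occurrences _≟_

  module _ (symmetry : IsSymmetry finite Ψ) where

    open IsSymmetry symmetry renaming (preservesOccurrences to pres)

    image-letter : ∀ x → ∃ λ y → Ψ [ x ] ≡ [ y ]
    image-letter x = length≡1⇒ (Ψ [ x ]) (preserves-length Ψ pres [ x ])

    -- Surjectivity gives a preimage word, and preservation of length makes it a letter.
    preimage-letter : ∀ y → ∃ λ x → Ψ [ x ] ≡ [ y ]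
    preimage-letter y with proj₂ bijective [ y ]
    ... | v , Ψv≡ with length≡1⇒ v (trans (sym (preserves-length Ψ pres v)) (cong length (Ψv≡ refl)))
    ...   | x , refl = x , Ψv≡ refl

    -- `σ` is the inverse of `π`, and `map σ ∘ Ψ` is the normalised map that fixes every letter.
    π σ : A → A
    π = proj₁ ∘ image-letter
    σ = proj₁ ∘ preimage-letter

    π∘σ : ∀ y → π (σ y) ≡ y
    π∘σ y = ∷-injectiveˡ (trans (sym (proj₂ (image-letter (σ y)))) (proj₂ (preimage-letter y)))

    π-injective : Injective _≡_ _≡_ π
    π-injective {x} {y} πx≡πy = ∷-injectiveˡ (proj₁ bijective (begin
      Ψ [ x ]   ≡⟨ proj₂ (image-letter x) ⟩
      [ π x ]   ≡⟨ cong [_] πx≡πy ⟩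
      [ π y ]   ≡⟨ proj₂ (image-letter y) ⟨
      Ψ [ y ]   ∎))

    σ-injective : Injective _≡_ _≡_ σ
    σ-injective {x} {y} σx≡σy = trans (sym (π∘σ x)) (trans (cong π σx≡σy) (π∘σ y))

    symmetry⇒permutation : RestrictsToPermutation Ψ
    symmetry⇒permutation =
      mk⤖ (π-injective , strictlySurjective⇒surjective λ y → σ y , π∘σ y) , proj₂ ∘ image-letter

    map-π∘map-σ : ∀ v → map π (map σ v) ≡ v
    map-π∘map-σ v = trans (sym (map-∘ v)) (trans (map-cong π∘σ v) (map-id v))

    symmetry⇒morphism⊎antimorphism : IsMorphism Ψ ⊎ IsAntimorphism Ψ
    symmetry⇒morphism⊎antimorphism = Sum.map
      (λ ≗id → ≗map⇒morphism λ v → trans (sym (map-π∘map-σ (Ψ v))) (cong (map π) (≗id v)))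
      (λ ≗reverse → ≗map∘reverse⇒antimorphism λ v →
        trans (sym (map-π∘map-σ (Ψ v))) (cong (map π) (≗reverse v)))
      (letter-fixing⇒≗id⊎≗reverse finite (map σ ∘ Ψ)
        (∘-preservesOccurrences Ψ (map σ) pres (map-preservesOccurrences σ-injective))
        -- Injectivity of `π` turns its right inverse `σ` into a left inverse.
        (λ x → trans (cong (map σ) (proj₂ (image-letter x))) (cong [_] (π-injective (π∘σ (π x))))))

  -- Pointwise equality suffices for the transfer, which avoids function extensionality.
  ≗-symmetry : ∀ Φ → Ψ ≗ Φ → Bijective _≡_ _≡_ Φ → PreservesOccurrences Φ → IsSymmetry finite Ψ
  ≗-symmetry Φ Ψ≗Φ bij pres = record
    { bijective            = bijective-≗ Ψ≗Φ bij
    ; preservesOccurrences = ≗-preservesOccurrences Ψ Φ Ψ≗Φ pres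
    }

  permuting⇒symmetry : (IsMorphism Ψ ⊎ IsAntimorphism Ψ) × RestrictsToPermutation Ψ → IsSymmetry finite Ψ
  permuting⇒symmetry (inj₁ hom , π , letters) =
    ≗-symmetry (map (Bijection.to π)) (morphism≗map letters hom)
      (map-bijective (Bijection.bijective π))
      (map-preservesOccurrences (Bijection.injective π))
  permuting⇒symmetry (inj₂ anti , π , letters) =
    ≗-symmetry (reverse ∘ map (Bijection.to π)) (antimorphism≗reverse∘map letters anti)
      (∘-bijective _≡_ _≡_ _≡_ (map-bijective (Bijection.bijective π)) reverse-bijective)
      (∘-preservesOccurrences (map (Bijection.to π)) reverse
        (map-preservesOccurrences (Bijection.injective π)) reverse-preservesOccurrences)

theorem13 : ∀ {a} {A : Set a} (finite : Finite A) (Ψ : List A → List A) →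
    IsSymmetry finite Ψ ⇔ ((IsMorphism Ψ ⊎ IsAntimorphism Ψ) × RestrictsToPermutation Ψ)
theorem13 finite Ψ = mk⇔
  (λ symmetry → symmetry⇒morphism⊎antimorphism finite symmetry , symmetry⇒permutation finite symmetry)
  (permuting⇒symmetry finite)
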